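{- Let $T$ be a complete first-order theory. If $T$ is fully VC-minimal, then $T$ has low VC-density.
   Context: $\mathfrak{C}$ denotes a monster model of $T$. "Formula" means a formula without parameters; $x$ denotes a single variable, $\overline{x}, \overline{y}$ finite tuples of variables, $\mathrm{lg}(\overline{y})$ the length of $\overline{y}$; $\theta^1 = \theta$, $\theta^0 = \neg\theta$. Independence dimension $\le 1$: a family $\mathcal{A}$ of subsets of a set $X$ has independence dimension $\le 1$ with respect to $X$ if there are no two distinct $B_0, B_1 \in \mathcal{A}$ such that all four sets $B_0^{s} \cap B_1^{t}$ ($s,t \in \{0,1\}$) are nonempty, where $B^1 = B$ and $B^0 = X \setminus B$. Fully VC-minimal: $T$ is fully VC-minimal if there is a family of formulas $\Psi$, each of which has at least $x$ as a free variable (possibly as a dummy variable), such that: (i) the set $\mathcal{A}_\Psi = \{\psi(\mathfrak{C};\overline{b}) : \psi(x;\overline{y}) \in \Psi, \overline{b} \in \mathfrak{C}^{\mathrm{lg}(\overline{y})}\}$ has independence dimension $\le 1$ with respect to $\mathfrak{C}$; and (ii) for every formula $\varphi(x;\overline{y})$ there is a boolean combination $\psi(x;\overline{y})$ of formulas from $\Psi$ with variables $(x;\overline{y})$ such that $\varphi(x;\overline{y})$ is $T$-equivalent to $\psi(x;\overline{y})$. VC-density: for a partitioned formula $\varphi(\overline{x};\overline{y})$ and $B \subseteq \mathfrak{C}^{\mathrm{lg}(\overline{y})}$, $S_\varphi(B)$ is the set of all consistent sets of formulas of the form $\{\varphi(\overline{x};\overline{b})^{t(\overline{b})} : \overline{b}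 \in B\}$ with $t : B \to \{0,1\}$. The formula $\varphi(\overline{x};\overline{y})$ has VC-density $\le \ell$ if there is $K < \omega$ such that $|S_\varphi(B)| \le K \cdot |B|^\ell$ for all finite nonempty $B \subseteq \mathfrak{C}^{\mathrm{lg}(\overline{y})}$. $T$ has low VC-density if every formula $\varphi(\overline{x};\overline{y})$ has VC-density $\le \mathrm{lg}(\overline{x})$. -}

module Defs where

open import Axiom.ExcludedMiddle using (ExcludedMiddle)
open import Data.Bool using (Bool; true; false)
open import Data.Empty.Polymorphic using (⊥)
open import Data.Fin using (Fin)
open import Data.List using (List; length)
open import Data.List.Membership.Propositional using () renaming (_∈_ to _∈ₗ_)
open import Data.Nat using (ℕ; suc; _+_; _*_; _^_; _≤_; NonZero)
open import Data.Product using (Σ; Σ-syntax; ∃; ∃-syntax; _×_; _,_)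
open import Data.Sum using (_⊎_)
open import Data.Vec using (Vec; []; _∷_; _++_; lookup; map)
open import Data.Vec.Relation.Unary.All using (All)
open import Data.Vec.Relation.Unary.Unique.Propositional using (Unique)
open import Function.Bundles using (_↣_; _↔_; _⇔_; Inverse)
open import Level using (Level; Setω) renaming (suc to lsuc)
open import Relation.Binary.PropositionalEquality using (_≡_)
open import Relation.Nullary using (¬_)
open import Relation.Unary using (Pred; _∈_; _∩_; ∁; _≐_; Satisfiable)

private
  variable
    ℓ ℓ′ : Level

-- The model theory below is classical; the metatheoretic law of excluded
-- middle is passed around as an explicit hypothesis.
Classical : Setω
Classical = ∀ ℓ → ExcludedMiddle ℓ

------------------------------------------------------------------------
-- First-order syntax

record Signature (ℓ : Level) : Set (lsuc ℓ) where
  field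
    Func : ℕ → Set ℓ
    Rel  : ℕ → Set ℓ

open Signature public

data Term (L : Signature ℓ) (n : ℕ) : Set ℓ where
  var : Fin n → Term L n
  fun : ∀ {k} → Func L k → Vec (Term L n) k → Term L n

-- Formula L n: parameter-free formulas whose free variables are among n
-- given ones (each possibly a dummy).  A quantifier binds variable zero of
-- its body.  A partitioned formula φ(x̄;ȳ) with lg(x̄) = k and lg(ȳ) = m is an
-- element of Formula L (k + m), the variables x̄ coming first.
data Formula (L : Signature ℓ) : ℕ → Set ℓ where
  bot      : ∀ {n} → Formula L n
  _≈ᶠ_     : ∀ {n} → Term L n → Term L n → Formula L n
  rel      : ∀ {n k} → Rel L k → Vec (Term L n) k → Formula L n
  ¬ᶠ_      : ∀ {n} → Formula L n → Formula L n
  _∧ᶠ_     : ∀ {n} → Formula L n → Formula L n → Formula L n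
  _∨ᶠ_     : ∀ {n} → Formula L n → Formula L n → Formula L n
  ∃ᶠ_ ∀ᶠ_  : ∀ {n} → Formula L (suc n) → Formula L n

Sentence : Signature ℓ → Set ℓ
Sentence L = Formula L 0

Theory : Signature ℓ → Set (lsuc ℓ)
Theory {ℓ} L = Pred (Sentence L) ℓ

_^ᶠ_ : {L : Signature ℓ} {n : ℕ} → Formula L n → Bool → Formula L n
θ ^ᶠ true  = θ
θ ^ᶠ false = ¬ᶠ θ

data BooleanCombination {L : Signature ℓ} {n : ℕ} (P : Pred (Formula L n) ℓ′) :
                        Formula L n → Set (ℓ Level.⊔ ℓ′) where
  base : ∀ {φ} → φ ∈ P → BooleanCombination P φ
  bot  : BooleanCombination P bot
  neg  : ∀ {φ} → BooleanCombination P φ → BooleanCombination P (¬ᶠ φ)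
  and  : ∀ {φ ψ} → BooleanCombination P φ → BooleanCombination P ψ →
         BooleanCombination P (φ ∧ᶠ ψ)
  or   : ∀ {φ ψ} → BooleanCombination P φ → BooleanCombination P ψ →
         BooleanCombination P (φ ∨ᶠ ψ)

------------------------------------------------------------------------
-- Semantics

record Structure (L : Signature ℓ) : Set (lsuc ℓ) where
  field
    Carrier  : Set ℓ
    nonempty : Carrier
    ⟦_⟧ᶠ     : ∀ {k} → Func L k → Vec Carrier k → Carrier
    ⟦_⟧ʳ     : ∀ {k} → Rel L k → Vec Carrier k → Set ℓ

module _ {L : Signature ℓ} (M : Structure L) where
  open Structure M

  mutual
    eval : ∀ {n} → Vec Carrier n → Term L n → Carrier
    eval v (var i)    = lookup v i
    eval v (fun f ts) = ⟦ f ⟧ᶠ (evals v ts)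

    evals : ∀ {n k} → Vec Carrier n → Vec (Term L n) k → Vec Carrier k
    evals v []       = []
    evals v (t ∷ ts) = eval v t ∷ evals v ts

  _⊨_[_] : ∀ {n} → Formula L n → Vec Carrier n → Set ℓ
  _⊨_[_] bot        v = ⊥
  _⊨_[_] (s ≈ᶠ t)   v = eval v s ≡ eval v t
  _⊨_[_] (rel r ts) v = ⟦ r ⟧ʳ (evals v ts)
  _⊨_[_] (¬ᶠ φ)     v = ¬ (_⊨_[_] φ v)
  _⊨_[_] (φ ∧ᶠ ψ)   v = _⊨_[_] φ v × _⊨_[_] ψ v
  _⊨_[_] (φ ∨ᶠ ψ)   v = _⊨_[_] φ v ⊎ _⊨_[_] ψ v
  _⊨_[_] (∃ᶠ φ)     v = ∃[ a ] (_⊨_[_] φ (a ∷ v))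
  _⊨_[_] (∀ᶠ φ)     v = ∀ a → _⊨_[_] φ (a ∷ v)

open Structure using (Carrier) public

_⊨ᵀ_ : {L : Signature ℓ} → Structure L → Theory L → Set ℓ
M ⊨ᵀ T = ∀ {σ} → σ ∈ T → M ⊨ σ [ [] ]

module _ {L : Signature ℓ} (T : Theory L) where

  Entails : Sentence L → Set (lsuc ℓ)
  Entails σ = ∀ (M : Structure L) → M ⊨ᵀ T → M ⊨ σ [ [] ]

  Complete : Set (lsuc ℓ)
  Complete = (∃[ M ] (M ⊨ᵀ T)) × (∀ σ → Entails σ ⊎ Entails (¬ᶠ σ))

  T-Equivalent : ∀ {n} → Formula L n → Formula L n → Set (lsuc ℓ)
  T-Equivalent φ ψ =
    ∀ (M : Structure L) → M ⊨ᵀ T → ∀ v → M ⊨ φ [ v ] ⇔ M ⊨ ψ [ v ]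

record ElementaryExtension {L : Signature ℓ} (M : Structure L) : Set (lsuc ℓ) where
  field
    extension  : Structure L
    embed      : Carrier M → Carrier extension
    elementary : ∀ {n} (φ : Formula L n) v →
                 M ⊨ φ [ v ] ⇔ extension ⊨ φ [ map embed v ]

record Automorphism {L : Signature ℓ} (M : Structure L) : Set ℓ where
  open Structure M using (⟦_⟧ᶠ; ⟦_⟧ʳ)
  field
    bijection : Carrier M ↔ Carrier M
  open Inverse bijection using (to) public
  field
    preserves-fun : ∀ {k} (f : Func L k) v → to (⟦ f ⟧ᶠ v) ≡ ⟦ f ⟧ᶠ (map to v)
    preserves-rel : ∀ {k} (r : Rel L k) v → ⟦ r ⟧ʳ v ⇔ ⟦ r ⟧ʳ (map to v)

------------------------------------------------------------------------
-- Formulas with parameters and types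

-- θ(x̄; b̄) with lg(x̄) = k and b̄ from M.
record ParamFormula {L : Signature ℓ} (M : Structure L) (k : ℕ) : Set ℓ where
  constructor _⟨_⟩
  field
    {arity}    : ℕ
    formula    : Formula L (k + arity)
    parameters : Vec (Carrier M) arity

open ParamFormula public

module _ {L : Signature ℓ} {M : Structure L} where

  -- Consistency is understood relative to the elementary diagram of M.
  Consistent : ∀ {k} → Pred (ParamFormula M k) ℓ → Set (lsuc ℓ)
  Consistent {k} p =
    Σ[ N ∈ ElementaryExtension M ] let open ElementaryExtension N in
    Σ[ a ∈ Vec (Carrier extension) k ]
      (∀ {θ} → θ ∈ p → extension ⊨ formula θ [ a ++ map embed (parameters θ) ])

  Realized : ∀ {k} → Pred (ParamFormula M k) ℓ → Set ℓ
  Realized {k} p =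
    Σ[ a ∈ Vec (Carrier M) k ] (∀ {θ} → θ ∈ p → M ⊨ formula θ [ a ++ parameters θ ])

------------------------------------------------------------------------
-- Monster models

-- |A| < |B|
_≺_ : Set ℓ → Set ℓ → Set ℓ
A ≺ B = (A ↣ B) × ¬ (B ↣ A)

-- Small subsets of M are given as images of families a : I → M with I ≺ κ.
module _ {L : Signature ℓ} (κ : Set ℓ) (M : Structure L) where

  Saturated : Set (lsuc ℓ)
  Saturated =
    ∀ (I : Set ℓ) → I ≺ κ → (a : I → Carrier M) (p : Pred (ParamFormula M 1) ℓ) →
    (∀ {θ} → θ ∈ p → All (λ c → ∃[ i ] (a i ≡ c)) (parameters θ)) →
    Consistent p → Realized p

  StronglyHomogeneous : Set (lsuc ℓ)
  StronglyHomogeneous =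
    ∀ (I : Set ℓ) → I ≺ κ → (a b : I → Carrier M) →
    (∀ {n} (φ : Formula L n) (is : Vec I n) →
       M ⊨ φ [ map a is ] ⇔ M ⊨ φ [ map b is ]) →
    Σ[ σ ∈ Automorphism M ] (∀ i → Automorphism.to σ (a i) ≡ b i)

record MonsterModel {L : Signature ℓ} (T : Theory L) : Set (lsuc ℓ) where
  field
    model       : Structure L
    models      : model ⊨ᵀ T
    κ           : Set ℓ
    κ-large     : (∃ (Func L) ⊎ ∃ (Rel L) ⊎ ℕ) ≺ κ
    saturated   : Saturated κ model
    homogeneous : StronglyHomogeneous κ model

------------------------------------------------------------------------
-- Independence dimension and full VC-minimality

_^ˢ_ : {X : Set ℓ} → Pred X ℓ′ → Bool → Pred X ℓ′
B ^ˢ true  = B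
B ^ˢ false = ∁ B

-- Subsets are compared extensionally, by _≐_.
IndependenceDimension≤1 : {X : Set ℓ} → Pred (Pred X ℓ) ℓ′ → Set (lsuc ℓ Level.⊔ ℓ′)
IndependenceDimension≤1 𝒜 =
  ¬ (∃[ B₀ ] ∃[ B₁ ] (B₀ ∈ 𝒜 × B₁ ∈ 𝒜 × ¬ (B₀ ≐ B₁) ×
       (∀ s t → Satisfiable ((B₀ ^ˢ s) ∩ (B₁ ^ˢ t)))))

module _ {L : Signature ℓ} {T : Theory L} (ℭ : MonsterModel T) where
  open MonsterModel ℭ using (model)

  -- Ψ n consists of the members ψ(x;ȳ) of Ψ with variables (x;ȳ), lg(ȳ) = n;
  -- a formula that is to be used with several tuples of variables occurs
  -- once for each of them.
  𝒜 : (∀ n → Pred (Formula L (1 + n)) ℓ) → Pred (Pred (Carrier model) ℓ) ℓ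
  𝒜 Ψ A = ∃[ n ] Σ[ ψ ∈ Formula L (1 + n) ] Σ[ b ∈ Vec (Carrier model) n ]
            (ψ ∈ Ψ n × A ≐ (λ c → model ⊨ ψ [ c ∷ b ]))

  FullyVCMinimal : Set (lsuc ℓ)
  FullyVCMinimal =
    Σ[ Ψ ∈ (∀ n → Pred (Formula L (1 + n)) ℓ) ]
      (IndependenceDimension≤1 (𝒜 Ψ) ×
       (∀ n (φ : Formula L (1 + n)) →
          ∃[ ψ ] (BooleanCombination (Ψ n) ψ × T-Equivalent T φ ψ)))

------------------------------------------------------------------------
-- VC-density

Card≤ : {A : Set ℓ} → Pred A ℓ′ → ℕ → Set (ℓ Level.⊔ ℓ′)
Card≤ P n = ∃[ xs ] (length xs ≤ n × (∀ {a} → a ∈ P → a ∈ₗ xs))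

module _ {L : Signature ℓ} {T : Theory L} (ℭ : MonsterModel T) where
  open MonsterModel ℭ using (model)

  -- A finite set B of size s is an enumeration without repetitions of its
  -- elements, and t : B → {0,1} is the vector of its values.
  signedInstances : ∀ k {m s} → Formula L (k + m) → Vec (Vec (Carrier model) m) s →
                    Vec Bool s → Pred (ParamFormula model k) ℓ
  signedInstances k φ B t θ = ∃[ i ] (θ ≡ (φ ^ᶠ lookup t i) ⟨ lookup B i ⟩)

  -- S_φ(B), with a consistent set {φ(x̄;b̄)^t(b̄) : b̄ ∈ B} represented by t:
  -- distinct t have contradictory, hence distinct, sets of formulas.
  S : ∀ k {m s} → Formula L (k + m) → Vec (Vec (Carrier model) m) s →
      Pred (Vec Bool s) (lsuc ℓ)
  S k φ B t = Consistent (signedInstances k φ B t)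

  VCDensity≤ : ∀ k {m} → Formula L (k + m) → ℕ → Set (lsuc ℓ)
  VCDensity≤ k {m} φ d =
    ∃[ K ] (∀ s .{{_ : NonZero s}} (B : Vec (Vec (Carrier model) m) s) → Unique B →
              Card≤ (S k φ B) (K * s ^ d))

  LowVCDensity : Set (lsuc ℓ)
  LowVCDensity = ∀ k m (φ : Formula L (k + m)) → VCDensity≤ k φ k

{-# OPTIONS --safe #-}

-- Fix a point p of the model and, for ψ ∈ Ψ and parameters w, let D(ψ,w) be
-- the set of those u at which ψ(u;w) and ψ(p;w) have different truth values,
-- i.e. ψ(𝔐;w) or its complement, whichever avoids p.  Independence dimension
-- ≤ 1 forces any two of these sets that meet to be nested.  Hence, among the
-- finitely many D(ψ,w), w from a finite set, that contain a given a, there is a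
-- least one, D(ψ₀,w₁), unless there is none at all, and a ∈ D(ψ,w) if and only
-- if D(ψ₀,w₁) ⊆ D(ψ,w).  So the truth value of ψ(a;w) is that of
-- ψ(p;w) xor D(ψ₀,w₁) ⊆ D(ψ,w), which does not mention a.  For φ(x₀,x̄;ȳ) and
-- given values of x̄, the φ-type of x₀ over B is thus defined by one of finitely
-- many formulas with a single parameter b₁ ∈ B besides p.  With x̄ left variable,
-- each of these is a formula in fewer object variables, so every variable
-- contributes one factor |B| to the number of types.
module Submission where

open import Axiom.ExcludedMiddle using (ExcludedMiddle)
open import Data.Bool using (Bool; true; false; _≟_)
open import Data.Empty using (⊥-elim)
open import Data.Fin using (Fin; zero; suc; fromℕ<; _↑ˡ_; _↑ʳ_)
open import Data.List using (List; []; _∷_; cartesianProduct)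
  renaming (_++_ to _++ₗ_; map to mapₗ; allFin to allFinₗ)
open import Data.List.Membership.Propositional using () renaming (_∈_ to _∈ₗ_)
open import Data.List.Membership.Propositional.Properties
  using (∈-++⁺ˡ; ∈-++⁺ʳ; ∈-map⁺; ∈-allFin; ∈-cartesianProduct⁺; ∈-cartesianProduct⁻)
open import Data.List.Properties using (length-++)
open import Data.List.Relation.Unary.Any using (here; there)
open import Data.Maybe using (Maybe; just; nothing)
open import Data.Nat using (ℕ; zero; suc; _+_; _*_; _^_; _≤_; z≤n; s≤s; NonZero; >-nonZero⁻¹)
open import Data.Nat.Properties
  using (≤-reflexive; ≤-trans; +-mono-≤)
open import Data.Nat.Tactic.RingSolver using (solve-∀)
open import Data.Product using (∃; ∃-syntax; _×_; _,_; proj₁; proj₂)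
open import Data.Product.Function.NonDependent.Propositional using (_×-⇔_)
open import Data.Sum using (_⊎_; inj₁; inj₂; [_,_]′)
open import Data.Sum.Function.Propositional using (_⊎-⇔_)
open import Data.Vec using (Vec; []; _∷_; _++_; lookup; map; allFin)
open import Data.Vec.Properties
  using (lookup-map; map-∘; map-id; map-cong; map-++; map-lookup-allFin;
         lookup-++ˡ; lookup-++ʳ; tabulate∘lookup; tabulate-cong)
open import Function using (_∘_; id)
open import Function.Bundles using (_⇔_; mk⇔; Equivalence)
open import Function.Construct.Composition using (_⇔-∘_)
open import Function.Construct.Identity using (⇔-id)
open import Function.Construct.Symmetry using (⇔-sym)
open import Function.Related.TypeIsomorphisms using (¬-cong-⇔; →-cong-⇔)
open import Level using (Level)
open import Relation.Binary.PropositionalEquality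
  using (_≡_; _≢_; refl; sym; trans; cong; cong₂; subst)
open import Relation.Nullary using (¬_; yes; no; contradiction)
open import Relation.Nullary.Decidable using (decidable-stable)
open import Relation.Unary using (Pred; _∈_; _∉_; _⊆_; _∪_)

open import Defs

private
  variable
    ℓ ℓ′ : Level
    k m n N s : ℕ
    A B C : Set ℓ

open Equivalence using (to; from)

-- Logical equivalences and exclusive or

⇔-refl : A ⇔ A
⇔-refl = ⇔-id _

⇔-trans : A ⇔ B → B ⇔ C → A ⇔ C
⇔-trans e f = f ⇔-∘ e

≡⇒⇔ : {P : A → Set ℓ} {x y : A} → x ≡ y → P x ⇔ P y
≡⇒⇔ refl = mk⇔ id id

∀-⇔ : {P : A → Set ℓ} {Q : A → Set ℓ′} → (∀ x → P x ⇔ Q x) → (∀ x → P x) ⇔ (∀ x → Q x)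
∀-⇔ e = mk⇔ (λ f x → to (e x) (f x)) (λ f x → from (e x) (f x))

∃-⇔ : {P : A → Set ℓ} {Q : A → Set ℓ′} → (∀ x → P x ⇔ Q x) → ∃ P ⇔ ∃ Q
∃-⇔ e = mk⇔ (λ (x , h) → x , to (e x) h) (λ (x , h) → x , from (e x) h)

infixr 3 _⊕_
_⊕_ : Set ℓ → Set ℓ → Set ℓ
A ⊕ B = (A × ¬ B) ⊎ (¬ A × B)

⊕-⇔ : {A A′ B B′ : Set ℓ} → A ⇔ A′ → B ⇔ B′ → (A ⊕ B) ⇔ (A′ ⊕ B′)
⊕-⇔ e f = (e ×-⇔ ¬-cong-⇔ f) ⊎-⇔ (¬-cong-⇔ e ×-⇔ f)

module _ (em : ExcludedMiddle ℓ) {A B : Set ℓ} where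

  -- Used with `A` the truth value at a given point and `B` that at `p`; then `A ⊕ B` says that the
  -- two points are separated.
  ⊕-cancel : A ⇔ (B ⊕ (A ⊕ B))
  ⊕-cancel with em {A} | em {B}
  ... | yes a | yes b = mk⇔ (λ _ → inj₁ (b , λ { (inj₁ (_ , ¬b)) → ¬b b ; (inj₂ (¬a , _)) → ¬a a }))
                            (λ _ → a)
  ... | yes a | no ¬b = mk⇔ (λ _ → inj₂ (¬b , inj₁ (a , ¬b))) (λ _ → a)
  ... | no ¬a | yes b = mk⇔ (λ a → contradiction a ¬a)
                            λ { (inj₁ (_ , ¬⊕)) → contradiction (inj₂ (¬a , b)) ¬⊕
                              ; (inj₂ (¬b , _)) → contradiction b ¬b }
  ... | no ¬a | no ¬b = mk⇔ (λ a → contradiction a ¬a)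
                            λ { (inj₁ (b , _)) → contradiction b ¬b
                              ; (inj₂ (_ , inj₁ (a , _))) → a
                              ; (inj₂ (_ , inj₂ (_ , b))) → contradiction b ¬b }

  ¬⊕⇒⇔ : ¬ (A ⊕ B) → A ⇔ B
  ¬⊕⇒⇔ ¬⊕ = mk⇔ (λ a → decidable-stable em λ ¬b → ¬⊕ (inj₁ (a , ¬b)))
                (λ b → decidable-stable em λ ¬a → ¬⊕ (inj₂ (¬a , b)))

-- Families of independence dimension ≤ 1

module _ {X : Set ℓ} where

  -- Written with `⊕` rather than by cases on whether `p` lies in `C`, so that a single formula with
  -- `p` as a parameter defines it.
  Separated : Pred X ℓ → X → Pred X ℓ
  Separated C p x = C x ⊕ C p

  module _ (em : ExcludedMiddle ℓ) (p : X) where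

    side : (C : Pred X ℓ) → ∃[ s ] (p ∈ C ^ˢ s)
    side C with em {C p}
    ... | yes p∈C = true  , p∈C
    ... | no  p∉C = false , p∉C

    unseparated-side : ∀ (C : Pred X ℓ) {x} s → x ∉ Separated C p → p ∈ C ^ˢ s → x ∈ C ^ˢ s
    unseparated-side C true  x∉D p∈C = from (¬⊕⇒⇔ em x∉D) p∈C
    unseparated-side C false x∉D p∉C = p∉C ∘ to (¬⊕⇒⇔ em x∉D)

    separated-side : ∀ (C : Pred X ℓ) {x} s t → x ∈ Separated C p → p ∈ C ^ˢ s → t ≢ s → x ∈ C ^ˢ t
    separated-side C true  true  _                p∈C t≢s = contradiction refl t≢s
    separated-side C false false _                p∉C t≢s = contradiction refl t≢s
    separated-side C true  false (inj₁ (_ , p∉C)) p∈C _   = contradiction p∈C p∉C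
    separated-side C true  false (inj₂ (x∉C , _)) _   _   = x∉C
    separated-side C false true  (inj₁ (x∈C , _)) _   _   = x∈C
    separated-side C false true  (inj₂ (_ , p∈C)) p∉C _   = contradiction p∈C p∉C

    ⊆-or-witness : (P Q : Pred X ℓ) → P ⊆ Q ⊎ ∃[ u ] (u ∈ P × u ∉ Q)
    ⊆-or-witness P Q with em {∃[ u ] (u ∈ P × u ∉ Q)}
    ... | yes w = inj₂ w
    ... | no ¬w = inj₁ λ u∈P → decidable-stable em λ u∉Q → ¬w (_ , u∈P , u∉Q)

    -- If x ∈ D ∩ E, u ∈ D ∖ E and v ∈ E ∖ D for D and E the separated sets of
    -- C₀ and C₁, then x, u, v, p lie in the four different cells of C₀ and C₁.
    meeting⇒nested : {𝒮 : Pred (Pred X ℓ) ℓ′} → IndependenceDimension≤1 𝒮 →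
      ∀ {C₀ C₁ x} → C₀ ∈ 𝒮 → C₁ ∈ 𝒮 → x ∈ Separated C₀ p → x ∈ Separated C₁ p →
      Separated C₀ p ⊆ Separated C₁ p ⊎ Separated C₁ p ⊆ Separated C₀ p
    meeting⇒nested indep {C₀} {C₁} {x} C₀∈𝒮 C₁∈𝒮 x∈D₀ x∈D₁
      with ⊆-or-witness (Separated C₀ p) (Separated C₁ p)
         | ⊆-or-witness (Separated C₁ p) (Separated C₀ p)
    ... | inj₁ D₀⊆D₁ | _          = inj₁ D₀⊆D₁
    ... | inj₂ _     | inj₁ D₁⊆D₀ = inj₂ D₁⊆D₀
    ... | inj₂ (u , u∈D₀ , u∉D₁) | inj₂ (v , v∈D₁ , v∉D₀) =
      ⊥-elim (indep (C₀ , C₁ , C₀∈𝒮 , C₁∈𝒮 , C₀≉C₁ , cells))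
      where
      s₀ = proj₁ (side C₀)
      s₁ = proj₁ (side C₁)
      p∈C₀ = proj₂ (side C₀)
      p∈C₁ = proj₂ (side C₁)
      cells : ∀ s t → ∃[ y ] (y ∈ C₀ ^ˢ s × y ∈ C₁ ^ˢ t)
      cells s t with s ≟ s₀ | t ≟ s₁
      ... | yes refl | yes refl = p , p∈C₀ , p∈C₁
      ... | yes refl | no t≢s₁  = v , unseparated-side C₀ s₀ v∉D₀ p∈C₀ , separated-side C₁ s₁ t v∈D₁ p∈C₁ t≢s₁
      ... | no s≢s₀  | yes refl = u , separated-side C₀ s₀ s u∈D₀ p∈C₀ s≢s₀ , unseparated-side C₁ s₁ u∉D₁ p∈C₁
      ... | no s≢s₀  | no t≢s₁  = x , separated-side C₀ s₀ s x∈D₀ p∈C₀ s≢s₀ , separated-side C₁ s₁ t x∈D₁ p∈C₁ t≢s₁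
      -- Distinctness comes from the cells themselves: one of them lies in `C₀` and outside `C₁`.
      C₀≉C₁ = λ (C₀⊆C₁ , _) → let (_ , y∈C₀ , y∉C₁) = cells true false in y∉C₁ (C₀⊆C₁ y∈C₀)

-- Least elements of finite lists

module _ (em : ExcludedMiddle ℓ) {A : Set ℓ′} (P : Pred A ℓ) (_≼_ : A → A → Set ℓ)
         (≼-trans : ∀ {x y z} → x ≼ y → y ≼ z → x ≼ z) where

  Least : List A → Set _
  Least xs = ∃[ x ] (x ∈ₗ xs × P x × (∀ {y} → y ∈ₗ xs → P y → x ≼ y))

  -- Comparability is asked only of entries satisfying `P`, since separated sets are known to be
  -- nested only when they share a point. The induction compares the head with a least entry of the
  -- tail.
  least : ∀ xs → (∀ {x y} → x ∈ₗ xs → y ∈ₗ xs → P x → P y → x ≼ y ⊎ y ≼ x) →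
          (∀ {x} → x ∈ₗ xs → ¬ P x) ⊎ Least xs
  least [] total = inj₁ λ ()
  least (x ∷ xs) total with em {P x} | least xs (λ i j → total (there i) (there j))
  ... | no ¬px | inj₁ none = inj₁ λ { (here refl) → ¬px ; (there i) → none i }
  ... | no ¬px | inj₂ (y , i , py , min) =
    inj₂ (y , there i , py , λ { (here refl) px → contradiction px ¬px ; (there j) → min j })
  ... | yes px | inj₁ none =
    inj₂ (x , here refl , px ,
          -- Reflexivity at `x` is totality for the pair of `x` with itself.
          λ { (here refl) _ → [ id , id ]′ (total (here refl) (here refl) px px)
            ; (there j) py → contradiction py (none j) })
  ... | yes px | inj₂ (y , i , py , min) with total (here refl) (there i) px py
  ...   | inj₁ x≼y =
    inj₂ (x , here refl , px ,
          λ { (here refl) _ → [ id , id ]′ (total (here refl) (here refl) px px)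
            ; (there j) pz → ≼-trans x≼y (min j pz) })
  ...   | inj₂ y≼x = inj₂ (y , there i , py , λ { (here refl) _ → y≼x ; (there j) → min j })

-- Cardinality bounds

Card≤-⊆ : {P : Pred A ℓ} {Q : Pred A ℓ′} → P ⊆ Q → Card≤ Q n → Card≤ P n
Card≤-⊆ P⊆Q (xs , len , cover) = xs , len , λ a∈P → cover (P⊆Q a∈P)

Card≤-≤ : {P : Pred A ℓ} → m ≤ n → Card≤ P m → Card≤ P n
Card≤-≤ m≤n (xs , len , cover) = xs , ≤-trans len m≤n , cover

Card≤-∪ : {P : Pred A ℓ} {Q : Pred A ℓ′} → Card≤ P m → Card≤ Q n → Card≤ (P ∪ Q) (m + n)
Card≤-∪ (xs , lx , cx) (ys , ly , cy) =
  xs ++ₗ ys , ≤-trans (≤-reflexive (length-++ xs)) (+-mono-≤ lx ly) ,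
  λ { (inj₁ a∈P) → ∈-++⁺ˡ (cx a∈P) ; (inj₂ a∈Q) → ∈-++⁺ʳ xs (cy a∈Q) }

Card≤-⋃ : (P : Fin s → Pred A ℓ) → (∀ i → Card≤ (P i) n) → Card≤ (λ a → ∃[ i ] (a ∈ P i)) (s * n)
Card≤-⋃ {s = zero}  P card = [] , z≤n , λ { (() , _) }
Card≤-⋃ {s = suc s} P card =
  Card≤-⊆ (λ { (zero , h) → inj₁ h ; (suc i , h) → inj₂ (i , h) })
    (Card≤-∪ (card zero) (Card≤-⋃ (P ∘ suc) (card ∘ suc)))

-- Renaming of variables

lift : Vec (Fin N) n → Vec (Fin (suc N)) (suc n)
lift is = zero ∷ map suc is

module _ {L : Signature ℓ} where

  mutual
    renameTerm : Vec (Fin N) n → Term L n → Term L N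
    renameTerm is (var i)    = var (lookup is i)
    renameTerm is (fun f ts) = fun f (renameTerms is ts)

    renameTerms : Vec (Fin N) n → Vec (Term L n) k → Vec (Term L N) k
    renameTerms is []       = []
    renameTerms is (t ∷ ts) = renameTerm is t ∷ renameTerms is ts

  rename : Vec (Fin N) n → Formula L n → Formula L N
  rename is bot        = bot
  rename is (t ≈ᶠ u)   = renameTerm is t ≈ᶠ renameTerm is u
  rename is (rel r ts) = rel r (renameTerms is ts)
  rename is (¬ᶠ φ)     = ¬ᶠ rename is φ
  rename is (φ ∧ᶠ ψ)   = rename is φ ∧ᶠ rename is ψ
  rename is (φ ∨ᶠ ψ)   = rename is φ ∨ᶠ rename is ψ
  rename is (∃ᶠ φ)     = ∃ᶠ rename (lift is) φ
  rename is (∀ᶠ φ)     = ∀ᶠ rename (lift is) φ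

  infixr 3 _xorᶠ_
  _xorᶠ_ : Formula L n → Formula L n → Formula L n
  φ xorᶠ ψ = (φ ∧ᶠ (¬ᶠ ψ)) ∨ᶠ ((¬ᶠ φ) ∧ᶠ ψ)

  ∃ᶠ* : ∀ k → Formula L (k + n) → Formula L n
  ∃ᶠ* zero    φ = φ
  ∃ᶠ* (suc k) φ = ∃ᶠ* k (∃ᶠ φ)

module _ {A : Set ℓ} where

  pick-∷ : (a : A) (v : Vec A N) (is : Vec (Fin N) n) → map (lookup (a ∷ v)) (map suc is) ≡ map (lookup v) is
  pick-∷ a v is = sym (map-∘ (lookup (a ∷ v)) suc is)

  pick-++ˡ : (v : Vec A m) (w : Vec A N) (is : Vec (Fin m) n) →
             map (lookup (v ++ w)) (map (_↑ˡ N) is) ≡ map (lookup v) is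
  pick-++ˡ v w is = trans (sym (map-∘ _ _ is)) (map-cong (lookup-++ˡ v w) is)

  pick-++ʳ : (v : Vec A m) (w : Vec A N) (is : Vec (Fin N) n) →
             map (lookup (v ++ w)) (map (m ↑ʳ_) is) ≡ map (lookup w) is
  pick-++ʳ v w is = trans (sym (map-∘ _ _ is)) (map-cong (lookup-++ʳ v w) is)

module _ {L : Signature ℓ} (M : Structure L) where
  open Structure M using (⟦_⟧ᶠ; ⟦_⟧ʳ)

  mutual
    eval-rename : (is : Vec (Fin N) n) (v : Vec (Carrier M) N) (t : Term L n) →
                  eval M v (renameTerm is t) ≡ eval M (map (lookup v) is) t
    eval-rename is v (var i)    = sym (lookup-map i (lookup v) is)
    eval-rename is v (fun f ts) = cong ⟦ f ⟧ᶠ (evals-rename is v ts)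

    evals-rename : (is : Vec (Fin N) n) (v : Vec (Carrier M) N) (ts : Vec (Term L n) k) →
                   evals M v (renameTerms is ts) ≡ evals M (map (lookup v) is) ts
    evals-rename is v []       = refl
    evals-rename is v (t ∷ ts) = cong₂ _∷_ (eval-rename is v t) (evals-rename is v ts)

  mutual
    ⊨-rename : (is : Vec (Fin N) n) (v : Vec (Carrier M) N) (φ : Formula L n) →
               M ⊨ rename is φ [ v ] ⇔ M ⊨ φ [ map (lookup v) is ]
    ⊨-rename is v bot        = ⇔-refl
    ⊨-rename is v (t ≈ᶠ u)   =
      ⇔-trans (≡⇒⇔ {P = _≡ eval M v (renameTerm is u)} (eval-rename is v t))
              (≡⇒⇔ {P = eval M (map (lookup v) is) t ≡_} (eval-rename is v u))
    ⊨-rename is v (rel r ts) = ≡⇒⇔ {P = ⟦ r ⟧ʳ} (evals-rename is v ts)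
    ⊨-rename is v (¬ᶠ φ)     = ¬-cong-⇔ (⊨-rename is v φ)
    ⊨-rename is v (φ ∧ᶠ ψ)   = ⊨-rename is v φ ×-⇔ ⊨-rename is v ψ
    ⊨-rename is v (φ ∨ᶠ ψ)   = ⊨-rename is v φ ⊎-⇔ ⊨-rename is v ψ
    ⊨-rename is v (∃ᶠ φ)     = ∃-⇔ λ a → ⊨-rename-lift is a v φ
    ⊨-rename is v (∀ᶠ φ)     = ∀-⇔ λ a → ⊨-rename-lift is a v φ

    ⊨-rename-lift : (is : Vec (Fin N) n) (a : Carrier M) (v : Vec (Carrier M) N) (φ : Formula L (suc n)) →
                    M ⊨ rename (lift is) φ [ a ∷ v ] ⇔ M ⊨ φ [ a ∷ map (lookup v) is ]
    ⊨-rename-lift is a v φ =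
      ⇔-trans (⊨-rename (lift is) (a ∷ v) φ) (≡⇒⇔ {P = λ w → M ⊨ φ [ a ∷ w ]} (pick-∷ a v is))

  ⊨-∃ᶠ* : ∀ k (φ : Formula L (k + n)) v → M ⊨ ∃ᶠ* k φ [ v ] ⇔ (∃[ a ] (M ⊨ φ [ a ++ v ]))
  ⊨-∃ᶠ* zero    φ v = mk⇔ (λ h → [] , h) (λ { ([] , h) → h })
  ⊨-∃ᶠ* (suc k) φ v = ⇔-trans (⊨-∃ᶠ* k (∃ᶠ φ) v)
    (mk⇔ (λ (as , a , h) → a ∷ as , h) (λ { (a ∷ as , h) → as , a , h }))

  ⊨-^ᶠ-unique : (φ : Formula L n) {v : Vec (Carrier M) n} (s t : Bool) →
                M ⊨ φ ^ᶠ s [ v ] → M ⊨ φ ^ᶠ t [ v ] → s ≡ t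
  ⊨-^ᶠ-unique φ true  true  _ _ = refl
  ⊨-^ᶠ-unique φ false false _ _ = refl
  ⊨-^ᶠ-unique φ true  false h k = contradiction h k
  ⊨-^ᶠ-unique φ false true  h k = contradiction k h

  ⊨-^ᶠ-cong : (φ : Formula L n) (ψ : Formula L N) {v : Vec (Carrier M) n} {w : Vec (Carrier M) N} →
              M ⊨ φ [ v ] ⇔ M ⊨ ψ [ w ] → ∀ t → M ⊨ φ ^ᶠ t [ v ] → M ⊨ ψ ^ᶠ t [ w ]
  ⊨-^ᶠ-cong φ ψ e true  = to e
  ⊨-^ᶠ-cong φ ψ e false = _∘ from e

-- Finite consistent sets are realized

module _ {L : Signature ℓ} {M : Structure L} {k : ℕ} where

  -- The conjuncts share their object variables, while each keeps its own block in the concatenated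
  -- parameter tuple.
  ⋀ : (Fin s → ParamFormula M k) → ParamFormula M k
  ⋀ {s = zero}  θ = (¬ᶠ bot) ⟨ [] ⟩
  ⋀ {s = suc s} θ =
    let m = arity (θ zero) ; n = arity (⋀ (θ ∘ suc)) in
    (rename (map (_↑ˡ (m + n)) (allFin k) ++ map (k ↑ʳ_) (map (_↑ˡ n) (allFin m))) (formula (θ zero)) ∧ᶠ
     rename (map (_↑ˡ (m + n)) (allFin k) ++ map (k ↑ʳ_) (map (m ↑ʳ_) (allFin n))) (formula (⋀ (θ ∘ suc))))
    ⟨ parameters (θ zero) ++ parameters (⋀ (θ ∘ suc)) ⟩

  -- The general map `e` covers both uses: `embed` into an elementary extension, and `id` on `M`.
  ⊨-⋀ : (M′ : Structure L) (e : Carrier M → Carrier M′) (a : Vec (Carrier M′) k)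
        (θ : Fin s → ParamFormula M k) →
        M′ ⊨ formula (⋀ θ) [ a ++ map e (parameters (⋀ θ)) ] ⇔
        (∀ i → M′ ⊨ formula (θ i) [ a ++ map e (parameters (θ i)) ])
  ⊨-⋀ {s = zero}  M′ e a θ = mk⇔ (λ _ ()) (λ _ ())
  ⊨-⋀ {s = suc s} M′ e a θ = ⇔-trans
    (⇔-trans (⊨-rename M′ _ _ (formula θ₀)) (≡⇒⇔ {P = λ v → M′ ⊨ formula θ₀ [ v ]} eq₀) ×-⇔
     ⇔-trans (⇔-trans (⊨-rename M′ _ _ (formula Θ)) (≡⇒⇔ {P = λ v → M′ ⊨ formula Θ [ v ]} eq₁))
             (⊨-⋀ M′ e a (θ ∘ suc)))
    (mk⇔ (λ { (h , hs) zero → h ; (h , hs) (suc i) → hs i }) (λ h → h zero , h ∘ suc))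
    where
    θ₀ = θ zero
    Θ  = ⋀ (θ ∘ suc)
    μ  = arity θ₀
    ν  = arity Θ
    b = map e (parameters θ₀)
    c = map e (parameters Θ)
    v = a ++ map e (parameters θ₀ ++ parameters Θ)
    v≡ : v ≡ a ++ (b ++ c)
    v≡ = cong (a ++_) (map-++ e (parameters θ₀) (parameters Θ))
    object : map (lookup v) (map (_↑ˡ (μ + ν)) (allFin k)) ≡ a
    object = trans (pick-++ˡ a _ (allFin k)) (map-lookup-allFin a)
    eq₀ : map (lookup v) (map (_↑ˡ (μ + ν)) (allFin k) ++ map (k ↑ʳ_) (map (_↑ˡ ν) (allFin μ))) ≡ a ++ b
    eq₀ = trans (map-++ (lookup v) (map (_↑ˡ (μ + ν)) (allFin k)) _) (cong₂ _++_ object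
      (trans (cong (λ u → map (lookup u) (map (k ↑ʳ_) (map (_↑ˡ ν) (allFin μ)))) v≡)
        (trans (pick-++ʳ a (b ++ c) _) (trans (pick-++ˡ b c (allFin μ)) (map-lookup-allFin b)))))
    eq₁ : map (lookup v) (map (_↑ˡ (μ + ν)) (allFin k) ++ map (k ↑ʳ_) (map (μ ↑ʳ_) (allFin ν))) ≡ a ++ c
    eq₁ = trans (map-++ (lookup v) (map (_↑ˡ (μ + ν)) (allFin k)) _) (cong₂ _++_ object
      (trans (cong (λ u → map (lookup u) (map (k ↑ʳ_) (map (μ ↑ʳ_) (allFin ν)))) v≡)
        (trans (pick-++ʳ a (b ++ c) _) (trans (pick-++ʳ b c (allFin ν)) (map-lookup-allFin c)))))

  -- Quantifying the object variables of the conjunction existentially leaves a formula about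
  -- parameters from `M`, whose truth descends from the extension to `M`.
  consistent⇒finitely-realized : {p : Pred (ParamFormula M k) ℓ} → Consistent p →
    (θ : Fin s → ParamFormula M k) → (∀ i → θ i ∈ p) →
    ∃[ a ] (∀ i → M ⊨ formula (θ i) [ a ++ parameters (θ i) ])
  consistent⇒finitely-realized (𝔑 , a , a⊨p) θ θ∈p =
    let open ElementaryExtension 𝔑
        Θ = ⋀ θ
        (b , b⊨Θ) = to (⊨-∃ᶠ* M k (formula Θ) (parameters Θ))
          (from (elementary (∃ᶠ* k (formula Θ)) (parameters Θ))
            (from (⊨-∃ᶠ* extension k (formula Θ) (map embed (parameters Θ)))
              (a , from (⊨-⋀ extension embed a θ) λ i → a⊨p (θ∈p i))))
        b⊨θ = to (⊨-⋀ M id b θ) (subst (λ v → M ⊨ formula Θ [ b ++ v ]) (sym (map-id _)) b⊨Θ)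
    in b , λ i → subst (λ v → M ⊨ formula (θ i) [ b ++ v ]) (map-id _) (b⊨θ i)

-- Boolean combinations

module _ {L : Signature ℓ} {P : Pred (Formula L n) ℓ} where

  -- A leaf keeps its proof of membership in `P`; for `P` taken from `Ψ` this puts its instances
  -- into `𝒜`.
  leaves : ∀ {φ} → BooleanCombination P φ → List (∃ P)
  leaves (base {φ} φ∈P) = (φ , φ∈P) ∷ []
  leaves bot            = []
  leaves (neg c)        = leaves c
  leaves (and c d)      = leaves c ++ₗ leaves d
  leaves (or c d)       = leaves c ++ₗ leaves d

  replaceLeaves : ∀ {φ} → (∃ P → Formula L N) → BooleanCombination P φ → Formula L N
  replaceLeaves g (base {φ} φ∈P) = g (φ , φ∈P)
  replaceLeaves g bot            = bot
  replaceLeaves g (neg c)        = ¬ᶠ replaceLeaves g c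
  replaceLeaves g (and c d)      = replaceLeaves g c ∧ᶠ replaceLeaves g d
  replaceLeaves g (or c d)       = replaceLeaves g c ∨ᶠ replaceLeaves g d

  -- Agreement of the leaves at one pair of valuations suffices. This matters because a scheme
  -- agrees with its leaf only for suitably chosen values.
  ⊨-replaceLeaves : (M : Structure L) (g : ∃ P → Formula L N) {v : Vec (Carrier M) n} {w : Vec (Carrier M) N} →
    ∀ {φ} (c : BooleanCombination P φ) →
    (∀ {l} → l ∈ₗ leaves c → M ⊨ proj₁ l [ v ] ⇔ M ⊨ g l [ w ]) →
    M ⊨ φ [ v ] ⇔ M ⊨ replaceLeaves g c [ w ]
  ⊨-replaceLeaves M g (base _)  h = h (here refl)
  ⊨-replaceLeaves M g bot       h = ⇔-refl
  ⊨-replaceLeaves M g (neg c)   h = ¬-cong-⇔ (⊨-replaceLeaves M g c h)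
  ⊨-replaceLeaves M g (and c d) h =
    ⊨-replaceLeaves M g c (h ∘ ∈-++⁺ˡ) ×-⇔ ⊨-replaceLeaves M g d (h ∘ ∈-++⁺ʳ (leaves c))
  ⊨-replaceLeaves M g (or c d)  h =
    ⊨-replaceLeaves M g c (h ∘ ∈-++⁺ˡ) ⊎-⇔ ⊨-replaceLeaves M g d (h ∘ ∈-++⁺ʳ (leaves c))

-- Defining schemes for types in one variable

module _ {L : Signature ℓ} where

  separatedᶠ : Formula L (1 + n) → Vec (Fin N) n → Fin N → Formula L (1 + N)
  separatedᶠ ψ w z = rename (lift w) ψ xorᶠ rename (map suc (z ∷ w)) ψ

  -- The scheme is indexed by ψ₀, with nothing for the type of a point lying in
  -- no separated set.
  schemeᶠ : Maybe (Formula L (1 + n)) → Formula L (1 + n) →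
            Vec (Fin N) n → Vec (Fin N) n → Fin N → Formula L N
  schemeᶠ nothing   ψ w₁ w z = rename (z ∷ w) ψ
  schemeᶠ (just ψ₀) ψ w₁ w z =
    rename (z ∷ w) ψ xorᶠ (∀ᶠ ((¬ᶠ separatedᶠ ψ₀ w₁ z) ∨ᶠ separatedᶠ ψ w z))

module _ {L : Signature ℓ} (M : Structure L) where

  Sep : Formula L (1 + n) → Vec (Carrier M) n → Carrier M → Pred (Carrier M) ℓ
  Sep ψ w p = Separated (λ u → M ⊨ ψ [ u ∷ w ]) p

  Scheme : Maybe (Formula L (1 + n)) → Formula L (1 + n) →
           Vec (Carrier M) n → Vec (Carrier M) n → Carrier M → Set ℓ
  Scheme nothing   ψ w₁ w p = M ⊨ ψ [ p ∷ w ]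
  Scheme (just ψ₀) ψ w₁ w p = M ⊨ ψ [ p ∷ w ] ⊕ (∀ u → u ∈ Sep ψ₀ w₁ p → u ∈ Sep ψ w p)

  ⊨-separatedᶠ : (ψ : Formula L (1 + n)) (w : Vec (Fin N) n) (z : Fin N) (v : Vec (Carrier M) N) (u : Carrier M) →
    M ⊨ separatedᶠ ψ w z [ u ∷ v ] ⇔ u ∈ Sep ψ (map (lookup v) w) (lookup v z)
  ⊨-separatedᶠ ψ w z v u = ⊕-⇔ (⊨-rename-lift M w u v ψ)
    (⇔-trans (⊨-rename M (map suc (z ∷ w)) (u ∷ v) ψ) (≡⇒⇔ {P = λ w → M ⊨ ψ [ w ]} (pick-∷ u v (z ∷ w))))

  module _ (em : ExcludedMiddle ℓ) where

    -- The syntax has no implication, so `schemeᶠ` expresses inclusion by negation and disjunction.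
    ¬⊎⇔→ : {A B : Set ℓ} → ((¬ A) ⊎ B) ⇔ (A → B)
    ¬⊎⇔→ {A} = mk⇔ (λ { (inj₁ ¬a) a → contradiction a ¬a ; (inj₂ b) _ → b }) classical
      where
      classical : _
      classical f with em {A}
      ... | yes a = inj₂ (f a)
      ... | no ¬a = inj₁ ¬a

    ⊨-schemeᶠ : ∀ g (ψ : Formula L (1 + n)) (w₁ w : Vec (Fin N) n) (z : Fin N) (v : Vec (Carrier M) N) →
      M ⊨ schemeᶠ g ψ w₁ w z [ v ] ⇔ Scheme g ψ (map (lookup v) w₁) (map (lookup v) w) (lookup v z)
    ⊨-schemeᶠ nothing   ψ w₁ w z v = ⊨-rename M (z ∷ w) v ψ
    ⊨-schemeᶠ (just ψ₀) ψ w₁ w z v = ⊕-⇔ (⊨-rename M (z ∷ w) v ψ)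
      (∀-⇔ λ u → ⇔-trans ¬⊎⇔→ (→-cong-⇔ (⊨-separatedᶠ ψ₀ w₁ z v u) (⊨-separatedᶠ ψ w z v u)))

module _ {L : Signature ℓ} {T : Theory L} (em : ExcludedMiddle ℓ) (ℭ : MonsterModel T)
         {Ψ : ∀ n → Pred (Formula L (1 + n)) ℓ} (indep : IndependenceDimension≤1 (𝒜 ℭ Ψ)) where
  open MonsterModel ℭ using (model)

  -- This list depends on the leaves alone and not on the parameter set, so its length affects only
  -- the constant `K`.
  schemes : List (∃ (Ψ n)) → List (Maybe (Formula L (1 + n)))
  schemes ls = nothing ∷ mapₗ (just ∘ proj₁) ls

  module _ (p a : Carrier model) (w : Fin s → Vec (Carrier model) n) where

    private
      D : ∃ (Ψ n) × Fin s → Pred (Carrier model) ℓ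
      D ((ψ , _) , i) = Sep model ψ (w i) p

      instance∈𝒜 : (x : ∃ (Ψ n) × Fin s) → (λ u → model ⊨ proj₁ (proj₁ x) [ u ∷ w (proj₂ x) ]) ∈ 𝒜 ℭ Ψ
      instance∈𝒜 ((ψ , ψ∈Ψ) , i) = n , ψ , w i , ψ∈Ψ , id , id

      chain : ∀ x y → a ∈ D x → a ∈ D y → (∀ u → u ∈ D x → u ∈ D y) ⊎ (∀ u → u ∈ D y → u ∈ D x)
      chain x y a∈x a∈y with meeting⇒nested em p indep (instance∈𝒜 x) (instance∈𝒜 y) a∈x a∈y
      ... | inj₁ x⊆y = inj₁ λ _ → x⊆y
      ... | inj₂ y⊆x = inj₂ λ _ → y⊆x

    -- The pair of `g` and `j` may depend on `a` but serves all leaves and all `i` at once, so one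
    -- pair describes the whole type of `a`.
    scheme-exists : .{{_ : NonZero s}} (ls : List (∃ (Ψ n))) →
      ∃[ g ] (g ∈ₗ schemes ls × ∃[ j ] (∀ {l} → l ∈ₗ ls → ∀ i →
        model ⊨ proj₁ l [ a ∷ w i ] ⇔ Scheme model g (proj₁ l) (w j) (w i) p))
    scheme-exists ls
      with least em (λ x → a ∈ D x) (λ x y → ∀ u → u ∈ D x → u ∈ D y) (λ f g u → g u ∘ f u)
                 (cartesianProduct ls (allFinₗ s)) (λ {x} {y} _ _ → chain x y)
    -- No parameter is singled out here; the index is a default, available because `s` is nonzero.
    ... | inj₁ none = nothing , here refl , fromℕ< (>-nonZero⁻¹ s) , λ l∈ i →
      ¬⊕⇒⇔ em (none (∈-cartesianProduct⁺ l∈ (∈-allFin i)))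
    ... | inj₂ ((l₀ , j) , x∈ , a∈D₀ , min) =
      just (proj₁ l₀) , there (∈-map⁺ _ (proj₁ (∈-cartesianProduct⁻ ls (allFinₗ s) x∈))) , j , λ l∈ i →
      -- Truth at `a` is truth at `p` xor membership of `a` in the separated set. Membership gives
      -- inclusion by minimality; conversely, inclusion is evaluated at `a`.
      ⇔-trans (⊕-cancel em)
        (⊕-⇔ ⇔-refl (mk⇔ (min (∈-cartesianProduct⁺ l∈ (∈-allFin i))) (λ D₀⊆D → D₀⊆D a a∈D₀)))

-- Counting types realized in the model

module _ {L : Signature ℓ} (M : Structure L) where

  -- Realization in the model replaces consistency, so that the induction can split a coordinate off
  -- an actual tuple.
  RealizedType : ∀ k {m} → Formula L (k + m) → Vec (Vec (Carrier M) m) s → Pred (Vec Bool s) ℓ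
  RealizedType k φ B t = ∃[ a ] (∀ i → M ⊨ φ ^ᶠ lookup t i [ a ++ lookup B i ])

  RealizedTypeBound : ∀ k {m} → Formula L (k + m) → ℕ → Set ℓ
  RealizedTypeBound k {m} φ K =
    ∀ s .{{_ : NonZero s}} (B : Vec (Vec (Carrier M) m) s) → Card≤ (RealizedType k φ B) (K * s ^ k)

  RealizedType₀-unique : (φ : Formula L m) {B : Vec (Vec (Carrier M) m) s} {t t′ : Vec Bool s} →
    t ∈ RealizedType 0 φ B → t′ ∈ RealizedType 0 φ B → t ≡ t′
  RealizedType₀-unique φ {t = t} {t′} ([] , h) ([] , h′) =
    trans (sym (tabulate∘lookup t)) (trans
      (tabulate-cong λ i → ⊨-^ᶠ-unique M φ (lookup t i) (lookup t′ i) (h i) (h′ i))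
      (tabulate∘lookup t′))

  -- Only the empty tuple can realize a type, so there is at most one. Deciding whether one exists
  -- avoids deciding each instance.
  RealizedType₀-bound : ExcludedMiddle ℓ → (φ : Formula L m) → RealizedTypeBound 0 φ 1
  RealizedType₀-bound em φ s B with em {∃[ t ] (t ∈ RealizedType 0 φ B)}
  ... | yes (t , t∈) = t ∷ [] , s≤s z≤n , λ {t′} t′∈ → here (RealizedType₀-unique φ {B} {t′} {t} t′∈ t∈)
  ... | no none      = []     , z≤n     , λ {t} t∈ → contradiction (t , t∈) none

-- Induction on the number of object variables

module _ {L : Signature ℓ} {T : Theory L} (em : ExcludedMiddle ℓ) (ℭ : MonsterModel T)
         (minimal : FullyVCMinimal ℭ) where
  open MonsterModel ℭ using (model; models)
  open Structure model using () renaming (nonempty to p)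

  private
    Ψ       = proj₁ minimal
    indep   = proj₁ (proj₂ minimal)
    combine = proj₂ (proj₂ minimal)

  module _ (k : ℕ) {m : ℕ} where

    private
      -- Layout of the new formula: the `k` remaining object variables, the tuple for b, the tuple
      -- for the distinguished b₁, and the base point.
      x̄ : Vec (Fin (k + (m + (m + 1)))) k
      x̄ = map (_↑ˡ _) (allFin k)

      ȳ ȳ₁ : Vec (Fin (k + (m + (m + 1)))) m
      ȳ  = map (k ↑ʳ_) (map (_↑ˡ _) (allFin m))
      ȳ₁ = map (k ↑ʳ_) (map (m ↑ʳ_) (map (_↑ˡ 1) (allFin m)))

      z : Fin (k + (m + (m + 1)))
      z = k ↑ʳ (m ↑ʳ (m ↑ʳ zero))

    module _ {ψ : Formula L (1 + (k + m))} (c : BooleanCombination (Ψ (k + m)) ψ) where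

      -- While the first object variable is eliminated, the other ones count as parameters of the
      -- leaves; in the result they are object variables again.
      definingᶠ : Maybe (Formula L (1 + (k + m))) → Formula L (k + (m + (m + 1)))
      definingᶠ g = replaceLeaves (λ l → schemeᶠ g (proj₁ l) (x̄ ++ ȳ₁) (x̄ ++ ȳ) z) c

      -- Every tuple is extended by the same b₁ and `p`, so there are still `s` of them.
      withParameter : Vec (Vec (Carrier model) m) s → Fin s → Vec (Vec (Carrier model) (m + (m + 1))) s
      withParameter B j = map (λ b → b ++ (lookup B j ++ (p ∷ []))) B

      module _ (a : Vec (Carrier model) k) (b b₁ : Vec (Carrier model) m) where
        private
          v : Vec (Carrier model) (k + (m + (m + 1)))
          v = a ++ (b ++ (b₁ ++ (p ∷ [])))

          pick-x̄ : map (lookup v) x̄ ≡ a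
          pick-x̄ = trans (pick-++ˡ a _ (allFin k)) (map-lookup-allFin a)

        pick-x̄ȳ : map (lookup v) (x̄ ++ ȳ) ≡ a ++ b
        pick-x̄ȳ = trans (map-++ (lookup v) x̄ ȳ) (cong₂ _++_ pick-x̄
          (trans (pick-++ʳ a _ _) (trans (pick-++ˡ b _ (allFin m)) (map-lookup-allFin b))))

        pick-x̄ȳ₁ : map (lookup v) (x̄ ++ ȳ₁) ≡ a ++ b₁
        pick-x̄ȳ₁ = trans (map-++ (lookup v) x̄ ȳ₁) (cong₂ _++_ pick-x̄
          (trans (pick-++ʳ a _ _) (trans (pick-++ʳ b _ _)
            (trans (pick-++ˡ b₁ _ (allFin m)) (map-lookup-allFin b₁)))))

        pick-z : lookup v z ≡ p
        pick-z = trans (lookup-++ʳ a _ _) (trans (lookup-++ʳ b _ _) (lookup-++ʳ b₁ _ _))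

        ⊨-definingᶠ : ∀ g x →
          (∀ {l} → l ∈ₗ leaves c →
             model ⊨ proj₁ l [ x ∷ (a ++ b) ] ⇔ Scheme model g (proj₁ l) (a ++ b₁) (a ++ b) p) →
          model ⊨ ψ [ x ∷ (a ++ b) ] ⇔ model ⊨ definingᶠ g [ v ]
        ⊨-definingᶠ g x h = ⊨-replaceLeaves model _ c λ {l} l∈ →
          ⇔-trans (h l∈) (⇔-sym (scheme-at-v (proj₁ l)))
          where
          scheme-at-v : ∀ χ → model ⊨ schemeᶠ g χ (x̄ ++ ȳ₁) (x̄ ++ ȳ) z [ v ] ⇔
                              Scheme model g χ (a ++ b₁) (a ++ b) p
          scheme-at-v χ = ⇔-trans (⊨-schemeᶠ model em g χ (x̄ ++ ȳ₁) (x̄ ++ ȳ) z v)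
            (⇔-trans (≡⇒⇔ {P = Scheme model g χ (map (lookup v) (x̄ ++ ȳ₁)) (map (lookup v) (x̄ ++ ȳ))} pick-z)
            (⇔-trans (≡⇒⇔ {P = λ w → Scheme model g χ (map (lookup v) (x̄ ++ ȳ₁)) w p} pick-x̄ȳ)
                     (≡⇒⇔ {P = λ w₁ → Scheme model g χ w₁ (a ++ b) p} pick-x̄ȳ₁)))

      DefinedBy : List (Maybe (Formula L (1 + (k + m)))) → Vec (Vec (Carrier model) m) s → Pred (Vec Bool s) ℓ
      DefinedBy gs B t =
        ∃[ g ] (g ∈ₗ gs × ∃[ j ] (t ∈ RealizedType model k (definingᶠ g) (withParameter B j)))

      -- Split a realization as `x ∷ a` and freeze `a`. The scheme for `x` does not mention `x`, so
      -- `a` alone realizes the same signs over the extended tuples.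
      RealizedType⊆DefinedBy : (φ : Formula L (suc k + m)) → (∀ v → model ⊨ φ [ v ] ⇔ model ⊨ ψ [ v ]) →
        .{{_ : NonZero s}} (B : Vec (Vec (Carrier model) m) s) →
        RealizedType model (suc k) φ B ⊆ DefinedBy (schemes em ℭ indep (leaves c)) B
      RealizedType⊆DefinedBy φ φ⇔ψ B {t} (x ∷ a , h) =
        let (g , g∈ , j , e) = scheme-exists em ℭ indep p x (λ i → a ++ lookup B i) (leaves c)
        in g , g∈ , j , a , λ i →
           subst (λ b → model ⊨ definingᶠ g ^ᶠ lookup t i [ a ++ b ]) (sym (lookup-map i _ B))
             (⊨-^ᶠ-cong model φ (definingᶠ g)
               (⇔-trans (φ⇔ψ _) (⊨-definingᶠ a (lookup B i) (lookup B j) g x (λ l∈ → e l∈ i)))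
               (lookup t i) (h i))

      -- The `s` choices of `j` contribute the additional factor `s`; the constants for the
      -- different `g` add up.
      DefinedBy-bound : (∀ g → ∃[ K ] RealizedTypeBound model k (definingᶠ g) K) → ∀ gs →
        ∃[ K ] (∀ s .{{_ : NonZero s}} (B : Vec (Vec (Carrier model) m) s) →
                  Card≤ (DefinedBy gs B) (K * s ^ suc k))
      DefinedBy-bound bound []       = 0 , λ s B → [] , z≤n , λ { (_ , () , _) }
      DefinedBy-bound bound (g ∷ gs) =
        let (K , card)   = bound g
            (K′ , card′) = DefinedBy-bound bound gs
        in K + K′ , λ s B →
           Card≤-⊆ (λ { (g , here refl , h) → inj₁ h ; (g , there g∈ , h) → inj₂ (g , g∈ , h) })
             (Card≤-≤ (≤-reflexive (arithmetic K K′ s (s ^ k)))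
               (Card≤-∪ (Card≤-⋃ _ λ j → card s (withParameter B j)) (card′ s B)))
        where
        arithmetic : ∀ K K′ s q → s * (K * q) + K′ * (s * q) ≡ (K + K′) * (s * q)
        arithmetic = solve-∀

  -- The induction on `k` must let `m` and `φ` vary: a step passes to the formulas
  -- `definingᶠ k c g`, with parameter tuples of length `m + (m + 1)`.
  realizedTypes-bound : ∀ k {m} (φ : Formula L (k + m)) → ∃[ K ] RealizedTypeBound model k φ K
  realizedTypes-bound zero    φ = 1 , RealizedType₀-bound model em φ
  realizedTypes-bound (suc k) {m} φ =
    let (ψ , c , φ⇔ψ) = combine (k + m) φ
        (K , card)    = DefinedBy-bound k c (λ g → realizedTypes-bound k (definingᶠ k c g))
                                        (schemes em ℭ indep (leaves c))
    in K , λ s B → Card≤-⊆ (λ {t} → RealizedType⊆DefinedBy k c φ (φ⇔ψ model models) B {t}) (card s B)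

-- As `B` is finite, a type realized in an elementary extension is already realized in the model.
S⊆RealizedType : {L : Signature ℓ} {T : Theory L} (ℭ : MonsterModel T) →
  let open MonsterModel ℭ using (model) in ∀ k {m} (φ : Formula L (k + m)) (B : Vec (Vec (Carrier model) m) s) →
  S ℭ k φ B ⊆ RealizedType model k φ B
S⊆RealizedType ℭ k φ B {t} consistent =
  consistent⇒finitely-realized consistent (λ i → (φ ^ᶠ lookup t i) ⟨ lookup B i ⟩) (λ i → i , refl)

theorem3p14 : Classical →
    ∀ {ℓ} (L : Signature ℓ) (T : Theory L) → Complete T →
    (ℭ : MonsterModel T) → FullyVCMinimal ℭ → LowVCDensity ℭ
theorem3p14 em {ℓ} L T _ ℭ minimal k m φ =
  let (K , card) = realizedTypes-bound (em ℓ) ℭ minimal k φ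
  in K , λ s B _ → Card≤-⊆ (λ {t} → S⊆RealizedType ℭ k φ B {t}) (card s B)
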